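{- Let $k\geq 1$, let $n\geq 1$ and $a_1,\ldots,a_k,b$ be integers with $a_i\neq 0$ for at least one $i$, and let $t_1,\ldots,t_k$ be positive divisors of $n$. For each prime $p\mid n$ let $r_p$, $m_p$, $e_p$ be as defined in the context. The restricted linear congruence $a_1x_1+\cdots +a_kx_k\equiv b \pmod{n}$, with $(x_i,n)=t_i$ ($1\leq i\leq k$), has no solutions if and only if one of the following cases holds: (i) there is a prime $p\mid n$ with $m_p\leq r_p$ and $p^{m_p-1}\nmid b$; (ii) there is a prime $p\mid n$ with $m_p\geq r_p+1$ and $p^{r_p}\nmid b$; (iii) there is a prime $p\mid n$ with $m_p\leq r_p$, $e_p=1$ and $p^{m_p}\mid b$; (iv) $n$ is even, $m_2 \leq r_2$, $e_2$ is odd and $2^{m_2}\mid b$; (v) $n$ is even, $m_2 \leq r_2$, $e_2$ is even and $2^{m_2-1}\, \|\, b$.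
   Context: $(u,v)$ denotes the greatest common divisor. A solution is an ordered $k$-tuple $\langle x_1,\ldots,x_k\rangle$ of integers modulo $n$ (note that $(x_i,n)$ depends only on $x_i$ modulo $n$). For every prime divisor $p$ of $n$: $r_p$ is the exponent of $p$ in the prime factorization of $n$; $m_p$ is the smallest integer $j\geq 1$ such that $p^j\nmid a_it_i$ for some $i\in\{1,\ldots,k\}$ (it exists because some $a_i\neq 0$); and $e_p=\#\{i: 1\leq i\leq k,\ p^{m_p}\nmid a_it_i\}$. The notation $p^r\,\|\,b$ means $p^r\mid b$ and $p^{r+1}\nmid b$ (so it never holds for $b=0$). -}

module Defs where

open import Data.Nat as ℕ using (ℕ; zero; suc; z≤n; s≤s)
import Data.Nat.Properties as ℕ
import Data.Nat.Divisibility as ℕ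
open import Data.Nat.GCD using (gcd)
open import Data.Nat.Primality using (Prime; prime⇒nonTrivial)
open import Data.Integer using (ℤ; +_; 0ℤ; ∣_∣; _-_; _*_; ≢-nonZero)
open import Data.Integer.Properties using (+-0-commutativeMonoid)
import Data.Integer.Properties as ℤ
open import Data.Integer.Divisibility using (_∣_)
open import Data.Fin using (Fin; toℕ)
open import Data.Fin.Properties using (any?)
open import Data.Vec using (count; allFin)
open import Data.Vec.Functional using (Vector)
open import Data.Product using (∃; _×_; _,_)
open import Relation.Nullary using (¬_; yes; no; ¬?; contradiction)
open import Relation.Nullary.Decidable using (_×-dec_)
open import Relation.Unary using (Decidable)
open import Relation.Binary.PropositionalEquality using (_≡_; _≢_; sym; cong)
open import Algebra.Properties.CommutativeMonoid.Sum +-0-commutativeMonoid using (sum)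

-- Integers modulo n are given by their least non-negative representatives.
-- Data.Integer.Divisibility is divisibility of absolute values, so the first
-- component is the congruence modulo n.
IsSolution : ∀ {k} (n : ℕ) → Vector ℤ k → ℤ → Vector ℕ k → Vector (Fin n) k → Set
IsSolution n a b t x =
  + n ∣ sum (λ i → a i * + toℕ (x i)) - b
  × (∀ i → gcd (toℕ (x i)) n ≡ t i)

infix 4 _^_∥_

_^_∥_ : ℕ → ℕ → ℤ → Set
p ^ r ∥ b = + (p ℕ.^ r) ∣ b × ¬ (+ (p ℕ.^ suc r) ∣ b)

SomeNotDivisible : ∀ {k} → ℕ → Vector ℤ k → Vector ℕ k → ℕ → Set
SomeNotDivisible p a t j = ∃ λ i → ¬ (+ (p ℕ.^ j) ∣ a i * + t i)

-- The defining property of m_p.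
IsLeastExponent : ∀ {k} → ℕ → Vector ℤ k → Vector ℕ k → ℕ → Set
IsLeastExponent p a t m =
  1 ℕ.≤ m × SomeNotDivisible p a t m
  × (∀ j → 1 ℕ.≤ j → SomeNotDivisible p a t j → m ℕ.≤ j)

-- e_p is  countNotDivisible p m_p a t.
countNotDivisible : ∀ {k} → ℕ → ℕ → Vector ℤ k → Vector ℕ k → ℕ
countNotDivisible {k} p m a t =
  count (λ i → ¬? ((p ℕ.^ m) ℕ.∣? ∣ a i * + t i ∣)) (allFin k)

-- The numbers r_p and m_p exist, so hypotheses characterising them by
-- _^_∥_ and IsLeastExponent can be met.

private
  least : ∀ {P : ℕ → Set} → Decidable P → ∀ N → P N →
          ∃ λ m → P m × (∀ j → P j → m ℕ.≤ j)
  least P? zero p = zero , p , λ _ _ → z≤n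
  least {P} P? (suc N) p with P? zero
  ... | yes p₀ = zero , p₀ , λ _ _ → z≤n
  ... | no ¬p₀ with least (λ j → P? (suc j)) N p
  ... | m , pm , min = suc m , pm , λ where
          zero    p₀ → contradiction p₀ ¬p₀
          (suc j) pj → s≤s (min j pj)

  n<p^n : ∀ {p} → 2 ℕ.≤ p → ∀ n → n ℕ.< p ℕ.^ n
  n<p^n 2≤p zero = s≤s z≤n
  n<p^n {p} 2≤p (suc n) = begin-strict
    suc n                  ≡⟨ ℕ.+-comm 1 n ⟩
    n ℕ.+ 1                <⟨ ℕ.+-monoˡ-< 1 ih ⟩
    p ℕ.^ n ℕ.+ 1          ≤⟨ ℕ.+-monoʳ-≤ (p ℕ.^ n) (ℕ.≤-trans (s≤s z≤n) ih) ⟩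
    p ℕ.^ n ℕ.+ p ℕ.^ n    ≡⟨ cong (p ℕ.^ n ℕ.+_) (sym (ℕ.+-identityʳ _)) ⟩
    2 ℕ.* p ℕ.^ n          ≤⟨ ℕ.*-monoˡ-≤ (p ℕ.^ n) 2≤p ⟩
    p ℕ.* p ℕ.^ n          ∎
    where
    open ℕ.≤-Reasoning
    ih = n<p^n 2≤p n

  p^n∤n : ∀ {p n} → 2 ℕ.≤ p → n ≢ 0 → ¬ (p ℕ.^ n ℕ.∣ n)
  p^n∤n {p} {n} 2≤p n≢0 d =
    ℕ.<⇒≱ (n<p^n 2≤p n) (ℕ.∣⇒≤ {{ℕ.≢-nonZero n≢0}} d)

exponent-exists : ∀ {p n} → Prime p → 1 ℕ.≤ n → ∃ λ r → p ^ r ∥ + n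
exponent-exists {p} {n@(suc n-1)} pp _
  with least (λ j → ¬? ((p ℕ.^ suc j) ℕ.∣? n)) n-1
             (p^n∤n (ℕ.nonTrivial⇒n>1 p {{prime⇒nonTrivial pp}}) λ ())
... | zero  , ¬d , _   = 0 , ℕ.1∣ n , ¬d
... | suc r , ¬d , min with (p ℕ.^ suc r) ℕ.∣? n
...   | yes d = suc r , d , ¬d
...   | no ¬e = contradiction (min r ¬e) ℕ.1+n≰n

leastExponent-exists : ∀ {k p} {a : Vector ℤ k} {t : Vector ℕ k} → Prime p →
  (∃ λ i → a i ≢ 0ℤ) → (∀ i → 1 ℕ.≤ t i) → ∃ λ m → IsLeastExponent p a t m
leastExponent-exists {k} {p} {a} {t} pp (i , aᵢ≢0) 1≤t
  with least (λ j → (1 ℕ.≤? j) ×-dec any? (λ i → ¬? ((p ℕ.^ j) ℕ.∣? ∣ a i * + t i ∣)))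
             ∣ a i * + t i ∣
             (ℕ.n≢0⇒n>0 c≢0 , i , p^n∤n (ℕ.nonTrivial⇒n>1 p {{prime⇒nonTrivial pp}}) c≢0)
  where
  c≢0 : ∣ a i * + t i ∣ ≢ 0
  c≢0 eq = ℕ.≢-nonZero⁻¹ ∣ a i * + t i ∣
    {{ℤ.i*j≢0 (a i) (+ t i) {{≢-nonZero aᵢ≢0}} {{ℕ.>-nonZero (1≤t i)}}}} eq
... | m , (1≤m , nd) , min = m , 1≤m , nd , λ j 1≤j ndj → min j (1≤j , ndj)

{-# OPTIONS --safe #-}
-- Every x with gcd (x , n) = t is t * y, and the condition on x becomes a condition on y: writing
-- c i = a i * t i, the congruence is solvable iff c · y ≡ b (mod n) has a solution whose entries
-- are coprime to n. By the Chinese remainder theorem this may be decided at each prime power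
-- p ^ r exactly dividing n. If p ^ r divides every c i, then y plays no role. Otherwise
-- c = p ^ (m - 1) * d with e entries of d prime to p, and by Hensel lifting along one such entry
-- it remains to solve d · y ≡ b / p ^ (m - 1) (mod p) with all entries of y units. A sum of e
-- units attains every residue if e ≥ 2 and p is odd, exactly the units if e = 1, and only the
-- parity of e if p = 2.
module Submission where

open import Defs
open import Data.Nat using (ℕ; zero; suc; _≤_; _<_; z≤n; s≤s; _∸_; _^_; NonZero)
import Data.Nat as ℕ
import Data.Nat.Properties as ℕ
import Data.Nat.Divisibility as ℕ
open import Data.Nat.Coprimality as Coprimality using (Coprime; coprime-Bézout; coprime-divisor)
open import Data.Nat.GCD using (gcd; gcd[m,n]∣m; gcd[m,n]∣n; gcd-greatest; module Bézout)
open import Data.Nat.Induction using (<-rec)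
open import Data.Nat.Primality
  using (Prime; euclidsLemma; prime⇒irreducible; prime⇒nonTrivial; prime⇒nonZero;
         prime[2]; ¬prime[1])
open import Data.Nat.Primality.Factorisation using (factorise; module PrimeFactorisation)
open import Data.Integer using (ℤ; +_; 0ℤ; 1ℤ; ∣_∣; _+_; _-_; _*_; -_)
import Data.Integer as ℤ
import Data.Integer.Properties as ℤ
open import Data.Integer.DivMod using (_%ℕ_; _/ℕ_; n%ℕd<d; a≡a%ℕn+[a/ℕn]*n)
open import Data.Integer.Divisibility using (_∣_)
open import Data.Integer.Divisibility.Signed
  using (divides; ∣ᵤ⇒∣; ∣⇒∣ᵤ; ∣-refl; ∣-trans; ∣m∣n⇒∣m+n; ∣m∣n⇒∣m-n; ∣m⇒∣-m; ∣m⇒∣m*n;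
         ∣n⇒∣m*n; ∣m+n∣m⇒∣n; ∣m+n∣n⇒∣m; *-monoʳ-∣; *-cancelˡ-∣; _∣?_)
  renaming (_∣_ to _∣ₛ_)
open import Data.Integer.Tactic.RingSolver using (solve-∀)
open import Data.Fin using (Fin; zero; suc; toℕ; fromℕ<)
open import Data.Fin.Properties using (toℕ-fromℕ<)
open import Data.List using (_∷_)
open import Data.List.Relation.Unary.All using (_∷_)
open import Data.Product using (∃; ∃₂; _×_; _,_; proj₁; proj₂)
open import Data.Sum using (_⊎_; inj₁; inj₂; [_,_]′; map₂)
import Data.Vec as Vec
open import Data.Vec.Functional using (Vector; tail; updateAt)
import Data.Vec.Functional as Vector
open import Function using (_∘_)
open import Function.Bundles using (_⇔_; mk⇔; Equivalence)
open import Relation.Nullary using (¬_; Dec; yes; no; contradiction)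
open import Relation.Nullary.Decidable using (decidable-stable)
open import Relation.Unary using (Decidable)
open import Relation.Binary.PropositionalEquality
  using (_≡_; _≢_; refl; sym; trans; cong; cong₂; subst; module ≡-Reasoning)
open import Algebra.Properties.CommutativeMonoid.Sum ℤ.+-0-commutativeMonoid using (sum; sum-cong-≗)

-- Prime powers and induction over coprime factors.

prime-factor : ∀ n → .{{ℕ.NonTrivial n}} → ∃ λ p → Prime p × p ℕ.∣ n
prime-factor n@(suc (suc _)) with factorise n
... | record { factors = p ∷ ps ; isFactorisation = eq ; factorsPrime = pp ∷ _ } =
      p , pp , subst (p ℕ.∣_) (sym eq) (ℕ.m∣m*n _)

no-common-prime⇒coprime : ∀ {m n} .{{_ : NonZero n}} →
  (∀ {p} → Prime p → p ℕ.∣ n → ¬ p ℕ.∣ m) → Coprime m n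
no-common-prime⇒coprime h {zero} (_ , 0∣n) =
  contradiction (ℕ.0∣⇒≡0 0∣n) (ℕ.≢-nonZero⁻¹ _)
no-common-prime⇒coprime h {suc zero} _ = refl
no-common-prime⇒coprime h {suc (suc d)} (d∣m , d∣n) with prime-factor (suc (suc d))
... | p , pp , p∣d = contradiction (ℕ.∣-trans p∣d d∣m) (h pp (ℕ.∣-trans p∣d d∣n))

prime∣prime⇒≡ : ∀ {p q} → Prime p → Prime q → p ℕ.∣ q → p ≡ q
prime∣prime⇒≡ pp pq p∣q with prime⇒irreducible pq p∣q
... | inj₁ refl = contradiction pp ¬prime[1]
... | inj₂ p≡q  = p≡q

prime∣^⇒≡ : ∀ {p q} j → Prime p → Prime q → p ℕ.∣ q ^ j → p ≡ q
prime∣^⇒≡ zero pp pq p∣1 with ℕ.∣1⇒≡1 p∣1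
... | refl = contradiction pp ¬prime[1]
prime∣^⇒≡ {q = q} (suc j) pp pq p∣ with euclidsLemma q (q ^ j) pp p∣
... | inj₁ p∣q = prime∣prime⇒≡ pp pq p∣q
... | inj₂ p∣qʲ = prime∣^⇒≡ j pp pq p∣qʲ

prime-power-coprime : ∀ {p n} j → Prime p → ¬ p ℕ.∣ n → Coprime (p ^ j) n
prime-power-coprime {p} j pp p∤n = Coprimality.sym (no-common-prime⇒coprime
  {{ℕ.m^n≢0 p j {{prime⇒nonZero pp}}}}
  λ pq q∣pʲ q∣n → p∤n (subst (ℕ._∣ _) (prime∣^⇒≡ j pq pp q∣pʲ) q∣n))

^-monoʳ-∣ : ∀ p {i j} → i ≤ j → p ^ i ℕ.∣ p ^ j
^-monoʳ-∣ p {j = j} z≤n = ℕ.1∣ (p ^ j)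
^-monoʳ-∣ p (s≤s i≤j) = ℕ.*-monoʳ-∣ p (^-monoʳ-∣ p i≤j)

∥⇒^∣⇒≤ : ∀ p {n r j} → p ^ r ∥ + n → p ^ j ℕ.∣ n → j ≤ r
∥⇒^∣⇒≤ p {r = r} {j} (_ , ∤) pʲ∣n with j ℕ.≤? r
... | yes j≤r = j≤r
... | no  j≰r = contradiction (ℕ.∣-trans (^-monoʳ-∣ p (ℕ.≰⇒> j≰r)) pʲ∣n) ∤

-- Strong induction: the full power of some prime factor `p` is split off, and the quotient `q` is
-- prime to `p` because the exponent is maximal. The prime powers in the hypothesis are all those
-- dividing `n`, not only the exact ones, so that the hypothesis passes to `q` at once.
coprime-induction : (Q : ℕ → Set) → Q 1 →
  (∀ {m n} → .{{NonZero m}} → .{{NonZero n}} → Coprime m n → Q m → Q n → Q (m ℕ.* n)) →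
  ∀ n → 1 ≤ n → (∀ p j → Prime p → p ℕ.∣ n → p ^ j ℕ.∣ n → Q (p ^ j)) → Q n
coprime-induction Q q₁ q* = <-rec _ step
  where
  step : ∀ n → (∀ {m} → m < n → 1 ≤ m →
           (∀ p j → Prime p → p ℕ.∣ m → p ^ j ℕ.∣ m → Q (p ^ j)) → Q m) →
         1 ≤ n → (∀ p j → Prime p → p ℕ.∣ n → p ^ j ℕ.∣ n → Q (p ^ j)) → Q n
  step 1 _ _ _ = q₁
  step n@(suc (suc _)) rec 1≤n qᵖ with prime-factor n
  ... | p , pp , p∣n with exponent-exists pp 1≤n
  ... | zero  , _ , ∤n = contradiction (subst (ℕ._∣ n) (sym (ℕ.*-identityʳ p)) p∣n) ∤n
  ... | suc r , pʳ∣n@(ℕ.divides q n≡q*pʳ) , ∤n =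
        subst Q (trans (ℕ.*-comm (p ^ suc r) q) (sym n≡q*pʳ))
          (q* {{pʳ≢0}} {{ℕ.>-nonZero 1≤q}} (prime-power-coprime (suc r) pp p∤q)
            (qᵖ p (suc r) pp p∣n pʳ∣n)
            (rec q<n 1≤q λ p′ j pp′ p′∣q pʲ∣q →
              qᵖ p′ j pp′ (ℕ.∣-trans p′∣q q∣n) (ℕ.∣-trans pʲ∣q q∣n)))
    where
    pʳ≢0 : NonZero (p ^ suc r)
    pʳ≢0 = ℕ.m^n≢0 p (suc r) {{prime⇒nonZero pp}}
    q∣n : q ℕ.∣ n
    q∣n = ℕ.divides (p ^ suc r) (trans n≡q*pʳ (ℕ.*-comm q _))
    p∤q : ¬ p ℕ.∣ q
    p∤q p∣q = ∤n (subst (p ^ suc (suc r) ℕ.∣_) (sym n≡q*pʳ) (ℕ.*-monoˡ-∣ (p ^ suc r) p∣q))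
    1≤q : 1 ≤ q
    1≤q = ℕ.n≢0⇒n>0 λ q≡0 → contradiction (trans n≡q*pʳ (cong (ℕ._* p ^ suc r) q≡0)) λ ()
    1<pʳ : 1 < p ^ suc r
    1<pʳ = ℕ.<-≤-trans (ℕ.nonTrivial⇒n>1 p {{prime⇒nonTrivial pp}})
             (ℕ.m≤m*n p (p ^ r) {{ℕ.m^n≢0 p r {{prime⇒nonZero pp}}}})
    q<n : q < n
    q<n = subst (q <_) (sym n≡q*pʳ) (ℕ.m<m*n q (p ^ suc r) {{ℕ.>-nonZero 1≤q}} 1<pʳ)

-- Bézout identities and congruences of integers.

bézout : ∀ {m n} → Coprime m n → ∃₂ λ u v → u * + m + v * + n ≡ 1ℤ
bézout {m} {n} c with coprime-Bézout c
... | Bézout.+- x y eq = + x , - + y , (begin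
  + x * + m + - + y * + n          ≡⟨ cong (_+ - + y * + n) (sym (ℤ.pos-* x m)) ⟩
  + (x ℕ.* m) + - + y * + n        ≡⟨ cong (λ z → + z + - + y * + n) (sym eq) ⟩
  1ℤ + + (y ℕ.* n) + - + y * + n   ≡⟨ cong (λ z → 1ℤ + z + - + y * + n) (ℤ.pos-* y n) ⟩
  1ℤ + + y * + n + - + y * + n     ≡⟨ cancel (+ y) (+ n) ⟩
  1ℤ                               ∎)
  where
  open ≡-Reasoning
  cancel : ∀ y n → 1ℤ + y * n + - y * n ≡ 1ℤ
  cancel = solve-∀
... | Bézout.-+ x y eq = - + x , + y , (begin
  - + x * + m + + y * + n          ≡⟨ cong (_+_ (- + x * + m)) (sym (ℤ.pos-* y n)) ⟩
  - + x * + m + + (y ℕ.* n)        ≡⟨ cong (λ z → - + x * + m + + z) (sym eq) ⟩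
  - + x * + m + (1ℤ + + (x ℕ.* m)) ≡⟨ cong (λ z → - + x * + m + (1ℤ + z)) (ℤ.pos-* x m) ⟩
  - + x * + m + (1ℤ + + x * + m)   ≡⟨ cancel (+ x) (+ m) ⟩
  1ℤ                               ∎)
  where
  open ≡-Reasoning
  cancel : ∀ x m → - x * m + (1ℤ + x * m) ≡ 1ℤ
  cancel = solve-∀

∣-resp : ∀ {m x y} → x ≡ y → m ∣ₛ x → m ∣ₛ y
∣-resp eq = subst (_ ∣ₛ_) eq

∣-congʳ : ∀ {m} x y → m ∣ₛ x - y → m ∣ₛ y → m ∣ₛ x
∣-congʳ x y h m∣y = ∣-resp (eq x y) (∣m∣n⇒∣m+n h m∣y)
  where
  eq : ∀ x y → x - y + y ≡ x
  eq = solve-∀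

∣-congˡ : ∀ {m} x y → m ∣ₛ x - y → m ∣ₛ x → m ∣ₛ y
∣-congˡ x y h m∣x = ∣-resp (eq x y) (∣m∣n⇒∣m-n m∣x h)
  where
  eq : ∀ x y → x - (x - y) ≡ y
  eq = solve-∀

mod-trans : ∀ {m} x y z → m ∣ₛ x - y → m ∣ₛ y - z → m ∣ₛ x - z
mod-trans x y z h h′ = ∣-resp (eq x y z) (∣m∣n⇒∣m+n h h′)
  where
  eq : ∀ x y z → x - y + (y - z) ≡ x - z
  eq = solve-∀

mod-sym : ∀ {m} x y → m ∣ₛ x - y → m ∣ₛ y - x
mod-sym x y h = ∣-resp (eq x y) (∣m⇒∣-m h)
  where
  eq : ∀ x y → - (x - y) ≡ y - x
  eq = solve-∀

euclid : ∀ {p} → Prime p → ∀ x y → + p ∣ₛ x * y → + p ∣ₛ x ⊎ + p ∣ₛ y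
euclid {p} pp x y p∣xy
  with euclidsLemma ∣ x ∣ ∣ y ∣ pp (subst (p ℕ.∣_) (ℤ.abs-* x y) (∣⇒∣ᵤ p∣xy))
... | inj₁ p∣x = inj₁ (∣ᵤ⇒∣ p∣x)
... | inj₂ p∣y = inj₂ (∣ᵤ⇒∣ p∣y)

prime∤1 : ∀ {p} → Prime p → ¬ + p ∣ₛ 1ℤ
prime∤1 pp p∣1 with ℕ.∣1⇒≡1 (∣⇒∣ᵤ p∣1)
... | refl = ¬prime[1] pp

coprime-inverse : ∀ {n} y → Coprime ∣ y ∣ n → ∃ λ w → + n ∣ₛ y * w - 1ℤ
coprime-inverse {n} y c with bézout c
... | u , v , eq with ∣ᵤ⇒∣ {y} {+ ∣ y ∣} ℕ.∣-refl
-- Bézout gives an inverse of `∣ y ∣`; the factor `s` with `+ ∣ y ∣ ≡ s * y` carries the sign of `y`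
-- into the inverse.
... | divides s ∣y∣≡sy = u * s , divides (- v) (begin
  y * (u * s) - 1ℤ                     ≡⟨ cong (_-_ (y * (u * s))) (sym eq) ⟩
  y * (u * s) - (u * + ∣ y ∣ + v * + n)  ≡⟨ cong (λ z → y * (u * s) - (u * z + v * + n)) ∣y∣≡sy ⟩
  y * (u * s) - (u * (s * y) + v * + n)  ≡⟨ lem y u s v (+ n) ⟩
  - v * + n                            ∎)
  where
  open ≡-Reasoning
  lem : ∀ y u s v n → y * (u * s) - (u * (s * y) + v * n) ≡ - v * n
  lem = solve-∀

-- Multiply `z` by `u * m + v * n ≡ 1`: in the first term `z` is replaced by its multiple of `n`, in
-- the second by its multiple of `m`.
coprime-∣* : ∀ {m n z} → Coprime m n → + m ∣ₛ z → + n ∣ₛ z → + (m ℕ.* n) ∣ₛ z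
coprime-∣* {m} {n} {z} c (divides q z≡qm) (divides q′ z≡q′n) with bézout c
... | u , v , eq = divides (u * q′ + v * q) (begin
  z                                      ≡⟨ sym (ℤ.*-identityˡ z) ⟩
  1ℤ * z                                 ≡⟨ cong (_* z) (sym eq) ⟩
  (u * + m + v * + n) * z                ≡⟨ ℤ.*-distribʳ-+ z (u * + m) (v * + n) ⟩
  u * + m * z + v * + n * z              ≡⟨ cong₂ (λ s t → u * + m * s + v * + n * t) z≡q′n z≡qm ⟩
  u * + m * (q′ * + n) + v * + n * (q * + m) ≡⟨ lem u v (+ m) (+ n) q q′ ⟩
  (u * q′ + v * q) * (+ m * + n)         ≡⟨ cong (_*_ (u * q′ + v * q)) (sym (ℤ.pos-* m n)) ⟩
  (u * q′ + v * q) * + (m ℕ.* n)         ∎)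
  where
  open ≡-Reasoning
  lem : ∀ u v m n q q′ → u * m * (q′ * n) + v * n * (q * m) ≡ (u * q′ + v * q) * (m * n)
  lem = solve-∀

-- Linear forms modulo `m`.

sum-cong-mod : ∀ {m k} (f g : Vector ℤ k) → (∀ i → m ∣ₛ f i - g i) → m ∣ₛ sum f - sum g
sum-cong-mod {k = zero} f g h = divides 0ℤ refl
sum-cong-mod {k = suc k} f g h =
  ∣-resp (lem (f zero) (g zero) (sum (tail f)) (sum (tail g)))
    (∣m∣n⇒∣m+n (h zero) (sum-cong-mod (tail f) (tail g) (h ∘ suc)))
  where
  lem : ∀ x y s t → x - y + (s - t) ≡ (x + s) - (y + t)
  lem = solve-∀

infix 8 _·_
_·_ : ∀ {k} → Vector ℤ k → Vector ℤ k → ℤ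
c · y = sum (λ i → c i * y i)

·-cong-mod : ∀ {m k} (c y z : Vector ℤ k) → (∀ i → m ∣ₛ y i - z i) → m ∣ₛ c · y - c · z
·-cong-mod c y z h = sum-cong-mod (λ i → c i * y i) (λ i → c i * z i) λ i →
  ∣-resp (lem (c i) (y i) (z i)) (∣n⇒∣m*n (c i) (h i))
  where
  lem : ∀ c y z → c * (y - z) ≡ c * y - c * z
  lem = solve-∀

∣-· : ∀ {m k} (c y : Vector ℤ k) → (∀ i → m ∣ₛ c i) → m ∣ₛ c · y
∣-· {k = zero} c y h = divides 0ℤ refl
∣-· {k = suc k} c y h = ∣m∣n⇒∣m+n (∣m⇒∣m*n (y zero) (h zero)) (∣-· (tail c) (tail y) (h ∘ suc))

·-scaleˡ : ∀ {k} P (c d y : Vector ℤ k) → (∀ i → c i ≡ P * d i) → c · y ≡ P * (d · y)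
·-scaleˡ {zero} P c d y h = sym (ℤ.*-zeroʳ P)
·-scaleˡ {suc k} P c d y h = begin
  c zero * y zero + tail c · tail y
    ≡⟨ cong₂ (λ s t → s * y zero + t) (h zero) (·-scaleˡ P (tail c) (tail d) (tail y) (h ∘ suc)) ⟩
  P * d zero * y zero + P * (tail d · tail y)
    ≡⟨ lem P (d zero) (y zero) (tail d · tail y) ⟩
  P * (d zero * y zero + tail d · tail y) ∎
  where
  open ≡-Reasoning
  lem : ∀ P d y s → P * d * y + P * s ≡ P * (d * y + s)
  lem = solve-∀

·-updateAt : ∀ {k} (d y : Vector ℤ k) i z → d · updateAt y i (_+ z) ≡ d · y + d i * z
·-updateAt d y zero z = lem (d zero) (y zero) z (tail d · tail y)
  where
  lem : ∀ d y z s → d * (y + z) + s ≡ d * y + s + d * z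
  lem = solve-∀
·-updateAt d y (suc i) z = trans
  (cong (_+_ (d zero * y zero)) (·-updateAt (tail d) (tail y) i z))
  (sym (ℤ.+-assoc (d zero * y zero) _ _))

-- Solutions in units and the Chinese remainder theorem.

-- Coprimality is stated prime by prime: in this form it passes to divisors of `n` directly, and for
-- a product of moduli Euclid's lemma splits it.
PrimeTo : ℕ → ℤ → Set
PrimeTo n y = ∀ {p} → Prime p → p ℕ.∣ n → ¬ + p ∣ₛ y

primeTo⇒coprime : ∀ {n} .{{_ : NonZero n}} y → PrimeTo n y → Coprime ∣ y ∣ n
primeTo⇒coprime y y⊥n = no-common-prime⇒coprime λ pp p∣n p∣y → y⊥n pp p∣n (∣ᵤ⇒∣ p∣y)

primeTo-cong-mod : ∀ {n} y z → + n ∣ₛ y - z → PrimeTo n z → PrimeTo n y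
primeTo-cong-mod y z n∣y-z z⊥n pp p∣n p∣y =
  z⊥n pp p∣n (∣-congˡ y z (∣-trans (∣ᵤ⇒∣ p∣n) n∣y-z) p∣y)

Solvable : ∀ {k} → ℕ → Vector ℤ k → ℤ → Set
Solvable n c b = ∃ λ y → (∀ i → PrimeTo n (y i)) × + n ∣ₛ c · y - b

solvable-1 : ∀ {k} (c : Vector ℤ k) b → Solvable 1 c b
solvable-1 c b =
  (λ _ → 1ℤ) , (λ _ pp p∣1 _ → contradiction (subst Prime (ℕ.∣1⇒≡1 p∣1) pp) ¬prime[1]) ,
  ∣ᵤ⇒∣ (ℕ.1∣ _)

solvable-∣ : ∀ {k m n} {c : Vector ℤ k} {b} → m ℕ.∣ n → Solvable n c b → Solvable m c b
solvable-∣ m∣n (y , y⊥n , sol) =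
  y , (λ i pp p∣m → y⊥n i pp (ℕ.∣-trans p∣m m∣n)) , ∣-trans (∣ᵤ⇒∣ m∣n) sol

solvable-* : ∀ {k m n} {c : Vector ℤ k} {b} → Coprime m n →
             Solvable m c b → Solvable n c b → Solvable (m ℕ.* n) c b
solvable-* {m = m} {n} {c} {b} m⊥n (y , y⊥m , soly) (z , z⊥n , solz) with bézout m⊥n
... | u , v , eq = x , x⊥mn ,
      coprime-∣* m⊥n (mod-trans (c · x) (c · y) b (·-cong-mod c x y x≡y) soly)
                     (mod-trans (c · x) (c · z) b (·-cong-mod c x z x≡z) solz)
  where
  x : Vector ℤ _
  -- Since `u * m` is 0 modulo `m` and 1 modulo `n`, this agrees with `y i` modulo `m` and with
  -- `z i` modulo `n`.
  x i = y i + u * + m * (z i - y i)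

  x≡y : ∀ i → + m ∣ₛ x i - y i
  x≡y i = divides (u * (z i - y i)) (lem (y i) (z i) u (+ m))
    where
    lem : ∀ y z u m → y + u * m * (z - y) - y ≡ u * (z - y) * m
    lem = solve-∀

  x≡z : ∀ i → + n ∣ₛ x i - z i
  x≡z i = divides (v * (y i - z i)) (begin
    y i + u * + m * (z i - y i) - z i          ≡⟨ lem₁ (y i) (z i) (u * + m) ⟩
    (1ℤ - u * + m) * (y i - z i)               ≡⟨ cong (λ w → (w - u * + m) * (y i - z i)) (sym eq) ⟩
    (u * + m + v * + n - u * + m) * (y i - z i) ≡⟨ lem₂ (u * + m) v (+ n) (y i - z i) ⟩
    v * (y i - z i) * + n                      ∎)
    where
    open ≡-Reasoning
    lem₁ : ∀ y z w → y + w * (z - y) - z ≡ (1ℤ - w) * (y - z)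
    lem₁ = solve-∀
    lem₂ : ∀ w v n d → (w + v * n - w) * d ≡ v * d * n
    lem₂ = solve-∀

  x⊥mn : ∀ i → PrimeTo (m ℕ.* n) (x i)
  x⊥mn i pp p∣mn with euclidsLemma m n pp p∣mn
  ... | inj₁ p∣m = primeTo-cong-mod (x i) (y i) (x≡y i) (y⊥m i) pp p∣m
  ... | inj₂ p∣n = primeTo-cong-mod (x i) (z i) (x≡z i) (z⊥n i) pp p∣n

-- From unit vectors to solutions with prescribed gcds.

-- Bézout for y and n exhibits t as an integral combination of t * y and n.
gcd-multiple : ∀ {n t x} .{{_ : NonZero n}} y → t ℕ.∣ n → PrimeTo n y →
               + n ∣ₛ + x - + t * y → gcd x n ≡ t
gcd-multiple {n} {t} {x} y t∣n y⊥n x≡ty =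
  ℕ.∣-antisym (g∣t (gcd[m,n]∣m x n) (gcd[m,n]∣n x n)) (gcd-greatest t∣x t∣n)
  where
  t∣x : t ℕ.∣ x
  t∣x = ∣⇒∣ᵤ {+ t} {+ x} (∣-congʳ (+ x) (+ t * y) (∣-trans (∣ᵤ⇒∣ t∣n) x≡ty) (∣m⇒∣m*n y ∣-refl))
  g∣t : ∀ {g} → g ℕ.∣ x → g ℕ.∣ n → g ℕ.∣ t
  g∣t {g} g∣x g∣n = g∣t′ (coprime-inverse y (primeTo⇒coprime y y⊥n))
    where
    g∣ₛn : + g ∣ₛ + n
    g∣ₛn = ∣ᵤ⇒∣ g∣n
    g∣ty : + g ∣ₛ + t * y
    g∣ty = ∣-congˡ (+ x) (+ t * y) (∣-trans g∣ₛn x≡ty) (∣ᵤ⇒∣ g∣x)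
    lem : ∀ t y w → t * y * w - t * (y * w - 1ℤ) ≡ t
    lem = solve-∀
    g∣t′ : (∃ λ w → + n ∣ₛ y * w - 1ℤ) → g ℕ.∣ t
    g∣t′ (w , n∣yw-1) = ∣⇒∣ᵤ {+ g} {+ t} (∣-resp (lem (+ t) y w)
      (∣m∣n⇒∣m-n (∣m⇒∣m*n w g∣ty) (∣n⇒∣m*n (+ t) (∣-trans g∣ₛn n∣yw-1))))

solvable⇒solution : ∀ {k n} .{{_ : NonZero n}} (a : Vector ℤ k) b (t : Vector ℕ k) →
  (∀ i → t i ℕ.∣ n) → Solvable n (λ i → a i * + t i) b → ∃ λ x → IsSolution n a b t x
solvable⇒solution {k} {n} a b t t∣n (y , y⊥n , sol) =
  x , ∣⇒∣ᵤ (mod-trans (sum ax) (c · y) b (sum-cong-mod ax (λ i → c i * y i) ax≡aty) sol) ,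
  λ i → gcd-multiple (y i) (t∣n i) (y⊥n i) (x≡ty i)
  where
  x : Vector (Fin n) k
  x i = fromℕ< (n%ℕd<d (+ t i * y i) n)

  c ax : Vector ℤ k
  c i = a i * + t i
  ax i = a i * + toℕ (x i)

  x≡ty : ∀ i → + n ∣ₛ + toℕ (x i) - + t i * y i
  x≡ty i = divides (- q) (begin
    + toℕ (x i) - z         ≡⟨ cong (λ w → + w - z) (toℕ-fromℕ< _) ⟩
    + (z %ℕ n) - z          ≡⟨ cong (_-_ (+ (z %ℕ n))) (a≡a%ℕn+[a/ℕn]*n z n) ⟩
    + (z %ℕ n) - (+ (z %ℕ n) + q * + n) ≡⟨ lem (+ (z %ℕ n)) q (+ n) ⟩
    - q * + n               ∎)
    where
    open ≡-Reasoning
    z q : ℤ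
    z = + t i * y i
    q = z /ℕ n
    lem : ∀ w q n → w - (w + q * n) ≡ - q * n
    lem = solve-∀

  ax≡aty : ∀ i → + n ∣ₛ ax i - c i * y i
  ax≡aty i = ∣-resp (lem (a i) (+ toℕ (x i)) (+ t i) (y i)) (∣n⇒∣m*n (a i) (x≡ty i))
    where
    lem : ∀ a x t y → a * (x - t * y) ≡ a * x - a * t * y
    lem = solve-∀

-- Residues of linear forms with unit entries.

primeTo-^ : ∀ {p} y j → Prime p → ¬ + p ∣ₛ y → PrimeTo (p ^ j) y
primeTo-^ y j pp p∤y pq q∣pʲ q∣y = p∤y (subst (λ s → + s ∣ₛ y) (prime∣^⇒≡ j pq pp q∣pʲ) q∣y)

odd⇒≡1 : ∀ z → ¬ + 2 ∣ₛ z → + 2 ∣ₛ z - 1ℤ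
odd⇒≡1 z 2∤z = go (z %ℕ 2) (n%ℕd<d z 2) (a≡a%ℕn+[a/ℕn]*n z 2)
  where
  q : ℤ
  q = z /ℕ 2
  go : ∀ s → s < 2 → z ≡ + s + q * + 2 → + 2 ∣ₛ z - 1ℤ
  go 0 _ eq = contradiction (divides q (trans eq (ℤ.+-identityˡ _))) 2∤z
  go 1 _ eq = divides q (trans (cong (_- 1ℤ) eq) (lem q (+ 2)))
    where
    lem : ∀ q d → 1ℤ + q * d - 1ℤ ≡ q * d
    lem = solve-∀
  go (suc (suc _)) (s≤s (s≤s ())) _

same-parity : ∀ x y → ¬ + 2 ∣ₛ x → ¬ + 2 ∣ₛ y → + 2 ∣ₛ x - y
same-parity x y 2∤x 2∤y = mod-trans x 1ℤ y (odd⇒≡1 x 2∤x) (mod-sym y 1ℤ (odd⇒≡1 y 2∤y))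

nonMultiples : ∀ {k} → ℕ → Vector ℤ k → ℕ
nonMultiples {zero} p d = 0
nonMultiples {suc k} p d with + p ∣? d zero
... | yes _ = nonMultiples p (tail d)
... | no  _ = suc (nonMultiples p (tail d))

-- Links the count over `allFin` that defines `e p` to a count by recursion on the vector. The
-- function `f` is arbitrary because the induction replaces it by `f ∘ suc`.
count≡nonMultiples : ∀ {A : Set} {P : A → Set} (P? : Decidable P)
  {k} (f : Fin k → A) p (d : Vector ℤ k) →
  (∀ i → P (f i) ⇔ (¬ + p ∣ₛ d i)) → Vec.count P? (Vec.tabulate f) ≡ nonMultiples p d
count≡nonMultiples P? {zero} f p d h = refl
count≡nonMultiples P? {suc k} f p d h with P? (f zero) | + p ∣? d zero
... | yes Pf | yes p∣d = contradiction p∣d (Equivalence.to (h zero) Pf)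
... | yes Pf | no  p∤d = cong suc (count≡nonMultiples P? (f ∘ suc) p (tail d) (h ∘ suc))
... | no ¬Pf | yes p∣d = count≡nonMultiples P? (f ∘ suc) p (tail d) (h ∘ suc)
... | no ¬Pf | no  p∤d = contradiction (Equivalence.from (h zero) p∤d) ¬Pf

nonMultiples≢0 : ∀ {p k} (d : Vector ℤ k) i → ¬ + p ∣ₛ d i → nonMultiples p d ≢ 0
nonMultiples≢0 {p} d zero p∤d₀ eq with + p ∣? d zero
... | yes p∣d₀ = p∤d₀ p∣d₀
... | no  _ = contradiction eq λ ()
nonMultiples≢0 {p} d (suc i) p∤dᵢ eq with + p ∣? d zero
... | yes _ = nonMultiples≢0 (tail d) i p∤dᵢ eq
... | no  _ = contradiction eq λ ()

nonMultiples≡0⇒∣· : ∀ {p k} (d y : Vector ℤ k) → nonMultiples p d ≡ 0 → + p ∣ₛ d · y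
nonMultiples≡0⇒∣· {p} d y eq = ∣-· d y λ i →
  decidable-stable (+ p ∣? d i) λ p∤dᵢ → nonMultiples≢0 d i p∤dᵢ eq

-- Modulo `p` a single term survives, a product of two units. The entries of `y` are assumed prime
-- to `p` only where those of `d` are, which is all that is known about the cofactors of a given
-- solution.
nonMultiples≡1⇒∤· : ∀ {p k} → Prime p → (d y : Vector ℤ k) → (∀ i → ¬ + p ∣ₛ d i → ¬ + p ∣ₛ y i) →
  nonMultiples p d ≡ 1 → ¬ + p ∣ₛ d · y
nonMultiples≡1⇒∤· {k = zero} pp d y u ()
nonMultiples≡1⇒∤· {p} {suc k} pp d y u eq p∣dy with + p ∣? d zero
... | yes p∣d₀ = nonMultiples≡1⇒∤· pp (tail d) (tail y) (u ∘ suc) eq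
      (∣m+n∣m⇒∣n p∣dy (∣m⇒∣m*n (y zero) p∣d₀))
... | no p∤d₀ = [ p∤d₀ , u zero p∤d₀ ]′ (euclid pp (d zero) (y zero)
      (∣m+n∣n⇒∣m p∣dy (nonMultiples≡0⇒∣· (tail d) (tail y) (ℕ.suc-injective eq))))

-- Modulo 2 a product of odd numbers is 1, so each odd coefficient contributes 1 and each even one
-- 0.
·≡nonMultiples-mod-2 : ∀ {k} (d y : Vector ℤ k) → (∀ i → ¬ + 2 ∣ₛ d i → ¬ + 2 ∣ₛ y i) →
  + 2 ∣ₛ d · y - + nonMultiples 2 d
·≡nonMultiples-mod-2 {zero} d y u = divides 0ℤ refl
·≡nonMultiples-mod-2 {suc k} d y u with + 2 ∣? d zero
... | yes 2∣d₀ = ∣-resp (sym (ℤ.+-assoc (d zero * y zero) _ _))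
      (∣m∣n⇒∣m+n (∣m⇒∣m*n (y zero) 2∣d₀) (·≡nonMultiples-mod-2 (tail d) (tail y) (u ∘ suc)))
... | no 2∤d₀ = ∣-resp (lem (d zero * y zero) (tail d · tail y) (+ nonMultiples 2 (tail d)))
      (∣m∣n⇒∣m+n (odd⇒≡1 (d zero * y zero) 2∤dy)
                 (·≡nonMultiples-mod-2 (tail d) (tail y) (u ∘ suc)))
  where
  2∤dy : ¬ + 2 ∣ₛ d zero * y zero
  2∤dy 2∣dy = [ 2∤d₀ , u zero 2∤d₀ ]′ (euclid prime[2] (d zero) (y zero) 2∣dy)
  lem : ∀ x s n → x - 1ℤ + (s - n) ≡ x + s - (1ℤ + n)
  lem = solve-∀

-- Solving modulo a prime and lifting to its powers.

-- The modulus is separate from `p` because lifting raises it from `p` to `p ^ j` while the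
-- condition on the entries stays the same.
LocallySolvable : ∀ {k} → ℕ → ℕ → Vector ℤ k → ℤ → Set
LocallySolvable p n c b = ∃ λ y → (∀ i → ¬ + p ∣ₛ y i) × + n ∣ₛ c · y - b

locallySolvable⇒solvable : ∀ {p k} j {c : Vector ℤ k} {b} → Prime p →
  LocallySolvable p (p ^ j) c b → Solvable (p ^ j) c b
locallySolvable⇒solvable j pp (y , p∤y , sol) = y , (λ i → primeTo-^ (y i) j pp (p∤y i)) , sol

abstract
  prime-inverse : ∀ {p} d j → Prime p → ¬ + p ∣ₛ d → ∃ λ w → + (p ^ j) ∣ₛ d * w - 1ℤ
  prime-inverse d j pp p∤d = coprime-inverse d
    (Coprimality.sym (prime-power-coprime j pp (p∤d ∘ ∣ᵤ⇒∣)))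

locallySolvable-cons : ∀ {p k} n (d : Vector ℤ (suc k)) b y₀ → ¬ + p ∣ₛ y₀ →
  LocallySolvable p n (tail d) (b - d zero * y₀) → LocallySolvable p n d b
locallySolvable-cons {p} n d b y₀ p∤y₀ (y , p∤y , sol) = y₀ Vector.∷ y , p∤y₀∷y ,
  ∣-resp (lem (d zero * y₀) (tail d · y) b) sol
  where
  p∤y₀∷y : ∀ i → ¬ + p ∣ₛ (y₀ Vector.∷ y) i
  p∤y₀∷y zero = p∤y₀
  p∤y₀∷y (suc i) = p∤y i
  lem : ∀ x s b → s - (b - x) ≡ x + s - b
  lem = solve-∀

abstract
  -- The case u = 1 is the only one that needs p odd: b − d₀ and b + d₀ are not both divisible by p.
  choose-unit : ∀ {p} → Prime p → p ≢ 2 → ∀ d₀ b u → ¬ + p ∣ₛ d₀ → (u ≡ 0 → ¬ + p ∣ₛ b) →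
    ∃ λ y₀ → ¬ + p ∣ₛ y₀ × (u ≡ 0 → + p ∣ₛ b - d₀ * y₀) × (u ≡ 1 → ¬ + p ∣ₛ b - d₀ * y₀)
  choose-unit {p} pp p≢2 d₀ b 0 p∤d₀ h = wit (prime-inverse d₀ 1 pp p∤d₀)
    where
    lem : ∀ d w b → (d * w - 1ℤ) * - b ≡ b - d * (w * b)
    lem = solve-∀
    wit : (∃ λ w → + (p ^ 1) ∣ₛ d₀ * w - 1ℤ) →
      ∃ λ y₀ → ¬ + p ∣ₛ y₀ × (0 ≡ 0 → + p ∣ₛ b - d₀ * y₀) × (0 ≡ 1 → ¬ + p ∣ₛ b - d₀ * y₀)
    wit (w , p^1∣) = w * b , p∤wb , (λ _ → ∣-resp (lem d₀ w b) (∣m⇒∣m*n (- b) p∣d₀w-1)) , λ ()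
      where
      p∣d₀w-1 : + p ∣ₛ d₀ * w - 1ℤ
      p∣d₀w-1 = ∣-trans (∣ᵤ⇒∣ (ℕ.m∣m*n 1)) p^1∣
      p∤wb : ¬ + p ∣ₛ w * b
      p∤wb p∣wb = [ (λ p∣w → prime∤1 pp (∣-congˡ (d₀ * w) 1ℤ p∣d₀w-1 (∣n⇒∣m*n d₀ p∣w))) , h refl ]′
        (euclid pp w b p∣wb)
  choose-unit {p} pp p≢2 d₀ b 1 p∤d₀ h with + p ∣? (b - d₀ * 1ℤ)
  ... | no  p∤ = 1ℤ , prime∤1 pp , (λ ()) , λ _ → p∤
  ... | yes p∣ = - 1ℤ , prime∤1 pp ∘ ∣m⇒∣-m , (λ ()) , λ _ p∣′ →
        [ (λ p∣2 → p≢2 (prime∣prime⇒≡ pp prime[2] (∣⇒∣ᵤ p∣2))) , p∤d₀ ]′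
        (euclid pp (+ 2) d₀ (∣-resp (lem d₀ b) (∣m∣n⇒∣m-n p∣′ p∣)))
    where
    lem : ∀ d b → b - d * - 1ℤ - (b - d * 1ℤ) ≡ (1ℤ + 1ℤ) * d
    lem = solve-∀
  choose-unit pp _ d₀ b (suc (suc _)) _ _ = 1ℤ , prime∤1 pp , (λ ()) , λ ()

-- Induction on the entries. Without unit coefficients only 0 is attained, with a single one only
-- units; the two hypotheses say that `b` is not ruled out. Where the coefficient is divisible by
-- `p` the entry 1 is taken. Otherwise `choose-unit` picks an entry for which the remaining target
-- is again admissible for the number of unit coefficients left.
solve-mod-odd-prime : ∀ {p k} → Prime p → p ≢ 2 → (d : Vector ℤ k) → ∀ b →
  (nonMultiples p d ≡ 0 → + p ∣ₛ b) → (nonMultiples p d ≡ 1 → ¬ + p ∣ₛ b) →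
  LocallySolvable p p d b
solve-mod-odd-prime {k = zero} pp p≢2 d b h₀ h₁ =
  (λ ()) , (λ ()) , ∣-resp (sym (ℤ.+-identityˡ (- b))) (∣m⇒∣-m (h₀ refl))
solve-mod-odd-prime {p} {suc k} pp p≢2 d b h₀ h₁ with + p ∣? d zero
... | yes p∣d₀ = locallySolvable-cons p d b 1ℤ (prime∤1 pp)
      (solve-mod-odd-prime pp p≢2 (tail d) (b - d zero * 1ℤ)
        (λ e≡0 → ∣m∣n⇒∣m-n (h₀ e≡0) p∣d₀*1)
        (λ e≡1 p∣ → h₁ e≡1 (∣-resp (lem b (d zero * 1ℤ)) (∣m∣n⇒∣m+n p∣ p∣d₀*1))))
  where
  p∣d₀*1 : + p ∣ₛ d zero * 1ℤ
  p∣d₀*1 = ∣m⇒∣m*n 1ℤ p∣d₀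
  lem : ∀ b x → b - x + x ≡ b
  lem = solve-∀
... | no p∤d₀ with choose-unit pp p≢2 (d zero) b (nonMultiples p (tail d)) p∤d₀ (h₁ ∘ cong suc)
...   | y₀ , p∤y₀ , h₀′ , h₁′ = locallySolvable-cons p d b y₀ p∤y₀
        (solve-mod-odd-prime pp p≢2 (tail d) (b - d zero * y₀) h₀′ h₁′)

-- The only unit modulo 2 is 1, so the all-ones vector serves.
solve-mod-2 : ∀ {k} (d : Vector ℤ k) b → + 2 ∣ₛ + nonMultiples 2 d - b → LocallySolvable 2 2 d b
solve-mod-2 d b h = (λ _ → 1ℤ) , (λ _ → prime∤1 prime[2]) ,
  mod-trans (d · (λ _ → 1ℤ)) (+ nonMultiples 2 d) b
    (·≡nonMultiples-mod-2 d (λ _ → 1ℤ) (λ _ _ → prime∤1 prime[2])) h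

-- Hensel lifting: the i-th variable, whose coefficient is invertible, absorbs the error.
locallySolvable-lift : ∀ {p k} j (d : Vector ℤ k) b i → Prime p → ¬ + p ∣ₛ d i →
  LocallySolvable p p d b → LocallySolvable p (p ^ j) d b
locallySolvable-lift {p} j d b i pp p∤dᵢ (y , p∤y , divides q eq) with prime-inverse (d i) j pp p∤dᵢ
... | w , pʲ∣dw-1 = updateAt y i (_+ z) , (λ i′ → p∤y i′ ∘ ∣-congˡ _ (y i′) (y′≡y y i i′)) ,
      ∣-resp (begin
        (d i * w - 1ℤ) * - (q * + p)   ≡⟨ lem₁ (d i) w q (+ p) ⟩
        q * + p + d i * z              ≡⟨ cong (_+ d i * z) (sym eq) ⟩
        d · y - b + d i * z            ≡⟨ lem₂ (d · y) b (d i * z) ⟩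
        d · y + d i * z - b            ≡⟨ cong (_- b) (sym (·-updateAt d y i z)) ⟩
        d · updateAt y i (_+ z) - b    ∎)
      (∣m⇒∣m*n (- (q * + p)) pʲ∣dw-1)
  where
  open ≡-Reasoning
  z : ℤ
  z = - (w * q) * + p
  lem₁ : ∀ d w q p → (d * w - 1ℤ) * - (q * p) ≡ q * p + d * (- (w * q) * p)
  lem₁ = solve-∀
  lem₂ : ∀ s b x → s - b + x ≡ s + x - b
  lem₂ = solve-∀
  lem₃ : ∀ y z → y + z - y ≡ z
  lem₃ = solve-∀
  y′≡y : ∀ {k} (y : Vector ℤ k) i i′ → + p ∣ₛ updateAt y i (_+ z) i′ - y i′
  y′≡y y zero zero = divides (- (w * q)) (lem₃ (y zero) z)
  y′≡y y zero (suc i′) = divides 0ℤ (ℤ.+-inverseʳ (y (suc i′)))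
  y′≡y y (suc i) zero = divides 0ℤ (ℤ.+-inverseʳ (y zero))
  y′≡y y (suc i) (suc i′) = y′≡y (tail y) i i′

locallySolvable-scale : ∀ {p n k} P (c d : Vector ℤ k) b → (∀ i → c i ≡ P * d i) →
  LocallySolvable p n d b → LocallySolvable p n c (P * b)
locallySolvable-scale P c d b c≡Pd (y , p∤y , sol) = y , p∤y ,
  ∣-resp (trans (lem P (d · y) b) (cong (_- P * b) (sym (·-scaleˡ P c d y c≡Pd)))) (∣n⇒∣m*n P sol)
  where
  lem : ∀ P s b → P * (s - b) ≡ P * s - P * b
  lem = solve-∀

-- Cofactors of a given solution.

-- If `p ^ r` divides `n` but not `t`, then `p` divides `n / t`; were `p` also to divide `x / t`,
-- then `p * t` would be a common divisor of `x` and `n` exceeding their gcd `t`.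
gcd-cofactor : ∀ {x n t} → 1 ≤ t → gcd x n ≡ t → ∃ λ y → + x ≡ + t * y ×
  (∀ p r → Prime p → p ^ r ℕ.∣ n → ¬ p ^ r ℕ.∣ t → ¬ + p ∣ₛ y)
gcd-cofactor {x} {n} {t} 1≤t gcd≡t = factor (subst (ℕ._∣ x) gcd≡t (gcd[m,n]∣m x n))
                                            (subst (ℕ._∣ n) gcd≡t (gcd[m,n]∣n x n))
  where
  factor : t ℕ.∣ x → t ℕ.∣ n → ∃ λ y → + x ≡ + t * y ×
    (∀ p r → Prime p → p ^ r ℕ.∣ n → ¬ p ^ r ℕ.∣ t → ¬ + p ∣ₛ y)
  factor (ℕ.divides y x≡yt) (ℕ.divides q n≡qt) =
    + y , trans (cong +_ (trans x≡yt (ℕ.*-comm y t))) (ℤ.pos-* t y) , unit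
    where
    unit : ∀ p r → Prime p → p ^ r ℕ.∣ n → ¬ p ^ r ℕ.∣ t → ¬ + p ∣ₛ + y
    unit p r pp pʳ∣n pʳ∤t p∣y with p ℕ.∣? q
    ... | no p∤q = pʳ∤t (coprime-divisor (prime-power-coprime r pp p∤q)
          (subst (p ^ r ℕ.∣_) n≡qt pʳ∣n))
    ... | yes p∣q = ℕ.<⇒≱ t<pt (ℕ.∣⇒≤ {{ℕ.>-nonZero 1≤t}} (subst (p ℕ.* t ℕ.∣_) gcd≡t
          (gcd-greatest (subst (p ℕ.* t ℕ.∣_) (sym x≡yt) (ℕ.*-monoˡ-∣ t (∣⇒∣ᵤ p∣y)))
                        (subst (p ℕ.* t ℕ.∣_) (sym n≡qt) (ℕ.*-monoˡ-∣ t p∣q)))))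
      where
      t<pt : t < p ℕ.* t
      t<pt = subst (t <_) (ℕ.*-comm t p) (ℕ.m<m*n t p {{ℕ.>-nonZero 1≤t}}
        (ℕ.nonTrivial⇒n>1 p {{prime⇒nonTrivial pp}}))

-- A weakened converse of `solvable⇒solution`: `x i / t i` may share with `n` a prime whose full
-- power in `n` already divides `t i`, so coprimality to `n` cannot be claimed.
solution-cofactors : ∀ {k n} (a : Vector ℤ k) b (t : Vector ℕ k) → (∀ i → 1 ≤ t i) →
  (∃ λ x → IsSolution n a b t x) → ∃ λ y → + n ∣ₛ (λ i → a i * + t i) · y - b ×
  (∀ i p r → Prime p → p ^ r ℕ.∣ n → ¬ p ^ r ℕ.∣ t i → ¬ + p ∣ₛ y i)
solution-cofactors a b t 1≤t (x , n∣ax-b , gcd≡t) =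
  (λ i → proj₁ (cofactor i)) ,
  ∣-resp (cong (_- b) (sum-cong-≗ ax≡aty)) (∣ᵤ⇒∣ n∣ax-b) ,
  λ i → proj₂ (proj₂ (cofactor i))
  where
  cofactor = λ i → gcd-cofactor (1≤t i) (gcd≡t i)
  ax≡aty : ∀ i → a i * + toℕ (x i) ≡ a i * + t i * proj₁ (cofactor i)
  ax≡aty i = trans (cong (_*_ (a i)) (proj₁ (proj₂ (cofactor i)))) (sym (ℤ.*-assoc (a i) (+ t i) _))

-- Splitting off the common power of `p` from the coefficients.

∣-below-least : ∀ {k p m} (a : Vector ℤ k) t → IsLeastExponent p a t m →
  ∀ j → j < m → ∀ i → + (p ^ j) ∣ₛ a i * + t i
-- Minimality of `m` speaks only of exponents at least 1, so exponent 0 is treated apart.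
∣-below-least a t _ zero _ i = ∣ᵤ⇒∣ (ℕ.1∣ _)
∣-below-least {p = p} a t (_ , _ , least) j@(suc _) j<m i with + (p ^ j) ∣? (a i * + t i)
... | yes pʲ∣c = pʲ∣c
... | no  pʲ∤c = contradiction (least j (s≤s z≤n) (i , pʲ∤c ∘ ∣ᵤ⇒∣)) (ℕ.<⇒≱ j<m)

pᵐ∣pᵐ⁻¹x⇔p∣x : ∀ {p} m x → Prime p → 1 ≤ m → + (p ^ m) ∣ₛ + (p ^ (m ∸ 1)) * x ⇔ + p ∣ₛ x
pᵐ∣pᵐ⁻¹x⇔p∣x {p} (suc m) x pp _ = mk⇔
  (λ h → *-cancelˡ-∣ P {{ℕ.m^n≢0 p m {{prime⇒nonZero pp}}}} (subst (_∣ₛ P * x) pᵐ≡ h))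
  (λ h → subst (_∣ₛ P * x) (sym pᵐ≡) (*-monoʳ-∣ P h))
  where
  P : ℤ
  P = + (p ^ m)
  pᵐ≡ : + (p ^ suc m) ≡ P * + p
  pᵐ≡ = trans (cong +_ (ℕ.*-comm p (p ^ m))) (ℤ.pos-* (p ^ m) p)

∣·-∣⇒∣ : ∀ {k s n} (c y : Vector ℤ k) b → s ℕ.∣ n → (∀ i → + s ∣ₛ c i) → + n ∣ₛ c · y - b → + s ∣ₛ b
∣·-∣⇒∣ c y b s∣n s∣c sol = ∣-congˡ (c · y) b (∣-trans (∣ᵤ⇒∣ s∣n) sol) (∣-· c y s∣c)

2∣⇔2∣ : ∀ x e → + 2 ∣ₛ x - + e → 2 ℕ.∣ e ⇔ + 2 ∣ₛ x
2∣⇔2∣ x e x≡e = mk⇔ (λ 2∣e → ∣-congʳ x (+ e) x≡e (∣ᵤ⇒∣ 2∣e))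
                    (λ 2∣x → ∣⇒∣ᵤ {+ 2} {+ e} (∣-congˡ x (+ e) x≡e 2∣x))

module LeadingCoefficients {k p m} (pp : Prime p) (a : Vector ℤ k) (t : Vector ℕ k)
                           (least : IsLeastExponent p a t m) where

  c : Vector ℤ k
  c i = a i * + t i

  1≤m : 1 ≤ m
  1≤m = proj₁ least

  m-1<m : m ∸ 1 < m
  m-1<m = ℕ.≤-reflexive (ℕ.m+[n∸m]≡n 1≤m)

  P : ℤ
  P = + (p ^ (m ∸ 1))

  P∣c : ∀ i → P ∣ₛ c i
  P∣c = ∣-below-least a t least (m ∸ 1) m-1<m

  abstract
    d : Vector ℤ k
    d i = _∣ₛ_.quotient (P∣c i)

    c≡Pd : ∀ i → c i ≡ P * d i
    c≡Pd i = trans (_∣ₛ_.equality (P∣c i)) (ℤ.*-comm (d i) P)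

  pᵐ∣P*⇔ : ∀ x → + (p ^ m) ∣ₛ P * x ⇔ + p ∣ₛ x
  pᵐ∣P*⇔ x = pᵐ∣pᵐ⁻¹x⇔p∣x m x pp 1≤m

  pᵐ∣c⇔p∣d : ∀ i → + (p ^ m) ∣ₛ c i ⇔ + p ∣ₛ d i
  pᵐ∣c⇔p∣d i = subst (λ x → + (p ^ m) ∣ₛ x ⇔ + p ∣ₛ d i) (sym (c≡Pd i)) (pᵐ∣P*⇔ (d i))

  abstract
    unit-index : Fin k
    unit-index = proj₁ (proj₁ (proj₂ least))

    p∤d-unit-index : ¬ + p ∣ₛ d unit-index
    p∤d-unit-index p∣d = proj₂ (proj₁ (proj₂ least))
      (∣⇒∣ᵤ (Equivalence.from (pᵐ∣c⇔p∣d unit-index) p∣d))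

  count≡ : countNotDivisible p m a t ≡ nonMultiples p d
  count≡ = count≡nonMultiples _ (λ i → i) p d λ i → mk⇔
    (λ pᵐ∤c p∣d → pᵐ∤c (∣⇒∣ᵤ (Equivalence.from (pᵐ∣c⇔p∣d i) p∣d)))
    (λ p∤d pᵐ∣c → p∤d (Equivalence.to (pᵐ∣c⇔p∣d i) (∣ᵤ⇒∣ {+ (p ^ m)} {c i} pᵐ∣c)))

  -- As `m ≤ r`, the congruence holds modulo `p ^ m`; cancelling `P`, which is `p ^ (m ∸ 1)`, leaves
  -- the modulus `p`.
  reduce : ∀ {r} y b′ → m ≤ r → + (p ^ r) ∣ₛ c · y - P * b′ → + p ∣ₛ d · y - b′
  reduce y b′ m≤r sol = Equivalence.to (pᵐ∣P*⇔ (d · y - b′)) (∣-resp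
    (trans (cong (_- P * b′) (·-scaleˡ P c d y c≡Pd)) (lem P (d · y) b′))
    (∣-trans (∣ᵤ⇒∣ (^-monoʳ-∣ p m≤r)) sol))
    where
    lem : ∀ P s b → P * s - P * b ≡ P * (s - b)
    lem = solve-∀

  -- The congruence for `d` is lifted all the way to `p ^ r` before multiplying by `P`, which avoids
  -- tracking the power that `P` contributes.
  solve-local : ∀ r b′ → LocallySolvable p p d b′ → Solvable (p ^ r) c (P * b′)
  solve-local r b′ sol =
    locallySolvable⇒solvable r {c} {P * b′} pp (locallySolvable-scale P c d b′ c≡Pd
      (locallySolvable-lift r d b′ unit-index pp p∤d-unit-index sol))

  -- Provides the condition under which the cofactor of a solution is prime to `p`: if `p ^ r`
  -- divided `t i`, then `p ^ m` would divide `c i`.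
  t-unit : ∀ {r} i → m ≤ r → ¬ + p ∣ₛ d i → ¬ p ^ r ℕ.∣ t i
  t-unit i m≤r p∤d pʳ∣t = p∤d (Equivalence.to (pᵐ∣c⇔p∣d i)
    (∣n⇒∣m*n (a i) (∣ᵤ⇒∣ (ℕ.∣-trans (^-monoʳ-∣ p m≤r) pʳ∣t))))

-- Solvability or an obstruction at each prime.

Obstruction : ℕ → ℤ → (r m e : ℕ → ℕ) → Set
Obstruction n b r m e =
    (∃ λ p → Prime p × p ℕ.∣ n × m p ≤ r p × ¬ (+ (p ^ (m p ∸ 1)) ∣ b))
  ⊎ (∃ λ p → Prime p × p ℕ.∣ n × suc (r p) ≤ m p × ¬ (+ (p ^ r p) ∣ b))
  ⊎ (∃ λ p → Prime p × p ℕ.∣ n × m p ≤ r p × e p ≡ 1 × + (p ^ m p) ∣ b)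
  ⊎ (2 ℕ.∣ n × m 2 ≤ r 2 × ¬ (2 ℕ.∣ e 2) × + (2 ^ m 2) ∣ b)
  ⊎ (2 ℕ.∣ n × m 2 ≤ r 2 × 2 ℕ.∣ e 2 × 2 ^ (m 2 ∸ 1) ∥ b)

module _ {k n} (a : Vector ℤ k) (b : ℤ) (t : Vector ℕ k) (r m e : ℕ → ℕ)
  (r-exponent : ∀ p → Prime p → p ℕ.∣ n → p ^ r p ∥ + n)
  (m-least : ∀ p → Prime p → p ℕ.∣ n → IsLeastExponent p a t (m p))
  (e-count : ∀ p → Prime p → p ℕ.∣ n → e p ≡ countNotDivisible p (m p) a t) where

  private
    c : Vector ℤ k
    c i = a i * + t i

    module AtPrime {p} (pp : Prime p) (p∣n : p ℕ.∣ n) where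
      open LeadingCoefficients pp a t (m-least p pp p∣n) public hiding (c)

      e≡ : e p ≡ nonMultiples p d
      e≡ = trans (e-count p pp p∣n) count≡

      pᵐ∣b⇔p∣b′ : ∀ b′ → b ≡ P * b′ → + (p ^ m p) ∣ b ⇔ + p ∣ₛ b′
      pᵐ∣b⇔p∣b′ b′ b≡Pb′ = mk⇔
        (λ h → Equivalence.to (pᵐ∣P*⇔ b′) (∣-resp b≡Pb′ (∣ᵤ⇒∣ {_} {b} h)))
        (λ h → ∣⇒∣ᵤ {_} {b} (∣-resp (sym b≡Pb′) (Equivalence.from (pᵐ∣P*⇔ b′) h)))

      abstract
        quotient-of-b : + (p ^ (m p ∸ 1)) ∣ b → ∃ λ b′ → b ≡ P * b′
        quotient-of-b P∣b with ∣ᵤ⇒∣ {P} {b} P∣b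
        ... | divides b′ b≡ = b′ , trans b≡ (ℤ.*-comm b′ P)

    -- Identifies the power excluded by `2 ^ (m 2 ∸ 1) ∥ b` as `2 ^ m 2`; the truncated subtraction
    -- is exact because `m 2` is at least 1.
    2¹⁺ᵐ⁻¹≡2ᵐ : (2∣n : 2 ℕ.∣ n) → 2 ^ suc (m 2 ∸ 1) ≡ 2 ^ m 2
    2¹⁺ᵐ⁻¹≡2ᵐ 2∣n = cong (2 ^_) (ℕ.m+[n∸m]≡n (proj₁ (m-least 2 prime[2] 2∣n)))

    -- The count of unit coefficients is never 0, thanks to `unit-index`, so the only failure is
    -- count 1 with `p` dividing `b′`, which is case (iii).
    reduced-dichotomy-odd : ∀ {p} (pp : Prime p) (p∣n : p ℕ.∣ n) → p ≢ 2 → m p ≤ r p →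
      ∀ b′ → b ≡ AtPrime.P pp p∣n * b′ →
      Obstruction n b r m e ⊎ LocallySolvable p p (AtPrime.d pp p∣n) b′
    reduced-dichotomy-odd {p} pp p∣n p≢2 m≤r b′ b≡Pb′ = split (e p ℕ.≟ 1) (+ p ∣? b′)
      where
      open AtPrime pp p∣n
      solve : (e p ≡ 1 → ¬ + p ∣ₛ b′) → LocallySolvable p p d b′
      solve h = solve-mod-odd-prime pp p≢2 d b′
        (λ e≡0 → contradiction e≡0 (nonMultiples≢0 d unit-index p∤d-unit-index))
        (h ∘ trans e≡)
      split : Dec (e p ≡ 1) → Dec (+ p ∣ₛ b′) → Obstruction n b r m e ⊎ LocallySolvable p p d b′
      split (yes e≡1) (yes p∣b′) = inj₁ (inj₂ (inj₂ (inj₁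
        (p , pp , p∣n , m≤r , e≡1 , Equivalence.from (pᵐ∣b⇔p∣b′ b′ b≡Pb′) p∣b′))))
      split (yes _) (no p∤b′) = inj₂ (solve λ _ → p∤b′)
      split (no e≢1) _ = inj₂ (solve λ e≡1 → contradiction e≡1 e≢1)

    -- Solvable when `e 2` and `b′` have the same parity; the two mismatches are cases (iv) and (v).
    -- The primality proof is a variable because `AtPrime.d` depends on it, and `reduced-dichotomy`
    -- supplies the one at hand.
    reduced-dichotomy-2 : (p2 : Prime 2) (2∣n : 2 ℕ.∣ n) → m 2 ≤ r 2 →
      ∀ b′ → b ≡ AtPrime.P p2 2∣n * b′ →
      Obstruction n b r m e ⊎ LocallySolvable 2 2 (AtPrime.d p2 2∣n) b′
    reduced-dichotomy-2 p2 2∣n m≤r b′ b≡Pb′ = split (2 ℕ.∣? e 2) (+ 2 ∣? b′)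
      where
      open AtPrime p2 2∣n
      solve : + 2 ∣ₛ + e 2 - b′ → LocallySolvable 2 2 d b′
      solve h = solve-mod-2 d b′ (subst (λ s → + 2 ∣ₛ + s - b′) e≡ h)
      split : Dec (2 ℕ.∣ e 2) → Dec (+ 2 ∣ₛ b′) → Obstruction n b r m e ⊎ LocallySolvable 2 2 d b′
      split (yes 2∣e) (yes 2∣b′) = inj₂ (solve (∣m∣n⇒∣m-n (∣ᵤ⇒∣ {_} {+ e 2} 2∣e) 2∣b′))
      split (no 2∤e) (no 2∤b′) = inj₂ (solve (same-parity (+ e 2) b′ (2∤e ∘ ∣⇒∣ᵤ) 2∤b′))
      split (no 2∤e) (yes 2∣b′) = inj₁ (inj₂ (inj₂ (inj₂ (inj₁
        (2∣n , m≤r , 2∤e , Equivalence.from (pᵐ∣b⇔p∣b′ b′ b≡Pb′) 2∣b′)))))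
      split (yes 2∣e) (no 2∤b′) = inj₁ (inj₂ (inj₂ (inj₂ (inj₂
        (2∣n , m≤r , 2∣e ,
         ∣⇒∣ᵤ {_} {b} (divides b′ (trans b≡Pb′ (ℤ.*-comm P b′))) ,
         λ 2ᵐ∣b → 2∤b′ (Equivalence.to (pᵐ∣b⇔p∣b′ b′ b≡Pb′)
           (subst (λ s → + s ∣ b) (2¹⁺ᵐ⁻¹≡2ᵐ 2∣n) 2ᵐ∣b)))))))

    reduced-dichotomy : ∀ {p} (pp : Prime p) (p∣n : p ℕ.∣ n) → Dec (p ≡ 2) → m p ≤ r p →
      ∀ b′ → b ≡ AtPrime.P pp p∣n * b′ →
      Obstruction n b r m e ⊎ LocallySolvable p p (AtPrime.d pp p∣n) b′
    reduced-dichotomy pp p∣n (yes refl) = reduced-dichotomy-2 pp p∣n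
    reduced-dichotomy pp p∣n (no p≢2) = reduced-dichotomy-odd pp p∣n p≢2

  -- All divisibilities involved are decidable, so the alternative is constructive; as a disjunction
  -- it can be carried through `coprime-induction`.
  local-dichotomy : ∀ {p} → Prime p → p ℕ.∣ n → Obstruction n b r m e ⊎ Solvable (p ^ r p) c b
  local-dichotomy {p} pp p∣n with m p ℕ.≤? r p
  ... | no m≰r = split (p ^ r p ℕ.∣? ∣ b ∣)
    where
    pʳ∣c : ∀ i → + (p ^ r p) ∣ₛ c i
    pʳ∣c = ∣-below-least a t (m-least p pp p∣n) (r p) (ℕ.≰⇒> m≰r)
    split : Dec (p ^ r p ℕ.∣ ∣ b ∣) → Obstruction n b r m e ⊎ Solvable (p ^ r p) c b
    split (no pʳ∤b) = inj₁ (inj₂ (inj₁ (p , pp , p∣n , ℕ.≰⇒> m≰r , pʳ∤b)))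
    split (yes pʳ∣b) = inj₂ ((λ _ → 1ℤ) , (λ _ pq _ → prime∤1 pq) ,
      ∣m∣n⇒∣m-n (∣-· c (λ _ → 1ℤ) pʳ∣c) (∣ᵤ⇒∣ {_} {b} pʳ∣b))
  ... | yes m≤r = split (p ^ (m p ∸ 1) ℕ.∣? ∣ b ∣)
    where
    open AtPrime pp p∣n
    solve : (∃ λ b′ → b ≡ P * b′) → Obstruction n b r m e ⊎ Solvable (p ^ r p) c b
    solve (b′ , b≡Pb′) = map₂
      (λ sol → subst (Solvable (p ^ r p) c) (sym b≡Pb′) (solve-local (r p) b′ sol))
      (reduced-dichotomy pp p∣n (p ℕ.≟ 2) m≤r b′ b≡Pb′)
    split : Dec (p ^ (m p ∸ 1) ℕ.∣ ∣ b ∣) → Obstruction n b r m e ⊎ Solvable (p ^ r p) c b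
    split (no P∤b) = inj₁ (inj₁ (p , pp , p∣n , m≤r , P∤b))
    split (yes P∣b) = solve (quotient-of-b P∣b)

  -- Obstructions exclude solutions.

  obstruction⇒no-solution : (∀ i → 1 ≤ t i) → Obstruction n b r m e →
    ¬ (∃ λ x → IsSolution n a b t x)
  obstruction⇒no-solution 1≤t obs sol with solution-cofactors a b t 1≤t sol
  ... | y , n∣cy-b , y-unit = refute obs
    where
    module AtPrimeWithSolution {p} (pp : Prime p) (p∣n : p ℕ.∣ n) where
      open AtPrime pp p∣n public

      pʳ∣cy-b : + (p ^ r p) ∣ₛ c · y - b
      pʳ∣cy-b = ∣-trans (∣ᵤ⇒∣ (proj₁ (r-exponent p pp p∣n))) n∣cy-b

      p∤y : m p ≤ r p → ∀ i → ¬ + p ∣ₛ d i → ¬ + p ∣ₛ y i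
      p∤y m≤r i p∤d = y-unit i p (r p) pp (proj₁ (r-exponent p pp p∣n)) (t-unit i m≤r p∤d)

      P∣b : m p ≤ r p → P ∣ₛ b
      P∣b m≤r = ∣·-∣⇒∣ c y b (^-monoʳ-∣ p (ℕ.≤-trans (ℕ.m∸n≤m (m p) 1) m≤r)) P∣c pʳ∣cy-b

      b′ : m p ≤ r p → ℤ
      b′ m≤r = proj₁ (quotient-of-b (∣⇒∣ᵤ (P∣b m≤r)))

      b≡Pb′ : ∀ m≤r → b ≡ P * b′ m≤r
      b≡Pb′ m≤r = proj₂ (quotient-of-b (∣⇒∣ᵤ (P∣b m≤r)))

      dy≡b′ : ∀ m≤r → + p ∣ₛ d · y - b′ m≤r
      dy≡b′ m≤r = reduce y (b′ m≤r) m≤r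
        (subst (λ s → + (p ^ r p) ∣ₛ c · y - s) (b≡Pb′ m≤r) pʳ∣cy-b)

      pᵐ∣b⇔p∣dy : m p ≤ r p → + (p ^ m p) ∣ b ⇔ + p ∣ₛ d · y
      pᵐ∣b⇔p∣dy m≤r = mk⇔
        (∣-congʳ (d · y) (b′ m≤r) (dy≡b′ m≤r) ∘ Equivalence.to (pᵐ∣b⇔p∣b′ _ (b≡Pb′ m≤r)))
        (Equivalence.from (pᵐ∣b⇔p∣b′ _ (b≡Pb′ m≤r)) ∘ ∣-congˡ (d · y) (b′ m≤r) (dy≡b′ m≤r))

    -- Modulo 2, `d · y` is congruent both to `e 2` and to `b′`. Cases (iv) and (v) each contradict
    -- one direction.
    2∣e⇔2ᵐ∣b : (2∣n : 2 ℕ.∣ n) → m 2 ≤ r 2 → 2 ℕ.∣ e 2 ⇔ + (2 ^ m 2) ∣ b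
    2∣e⇔2ᵐ∣b 2∣n m≤r = mk⇔
      (Equivalence.from (pᵐ∣b⇔p∣dy m≤r) ∘ Equivalence.to 2∣e⇔2∣dy)
      (Equivalence.from 2∣e⇔2∣dy ∘ Equivalence.to (pᵐ∣b⇔p∣dy m≤r))
      where
      open AtPrimeWithSolution prime[2] 2∣n
      2∣e⇔2∣dy : 2 ℕ.∣ e 2 ⇔ + 2 ∣ₛ d · y
      2∣e⇔2∣dy = 2∣⇔2∣ (d · y) (e 2)
        (subst (λ s → + 2 ∣ₛ d · y - + s) (sym e≡) (·≡nonMultiples-mod-2 d y (p∤y m≤r)))

    refute : ¬ Obstruction n b r m e
    refute (inj₁ (p , pp , p∣n , m≤r , P∤b)) =
      P∤b (∣⇒∣ᵤ {_} {b} (AtPrimeWithSolution.P∣b pp p∣n m≤r))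
    refute (inj₂ (inj₁ (p , pp , p∣n , r<m , pʳ∤b))) = pʳ∤b (∣⇒∣ᵤ {_} {b}
      (∣·-∣⇒∣ c y b ℕ.∣-refl (∣-below-least a t (m-least p pp p∣n) (r p) r<m) pʳ∣cy-b))
      where open AtPrimeWithSolution pp p∣n
    refute (inj₂ (inj₂ (inj₁ (p , pp , p∣n , m≤r , e≡1 , pᵐ∣b)))) =
      nonMultiples≡1⇒∤· pp d y (p∤y m≤r) (trans (sym e≡) e≡1)
        (Equivalence.to (pᵐ∣b⇔p∣dy m≤r) pᵐ∣b)
      where open AtPrimeWithSolution pp p∣n
    refute (inj₂ (inj₂ (inj₂ (inj₁ (2∣n , m≤r , 2∤e , 2ᵐ∣b))))) =
      2∤e (Equivalence.from (2∣e⇔2ᵐ∣b 2∣n m≤r) 2ᵐ∣b)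
    refute (inj₂ (inj₂ (inj₂ (inj₂ (2∣n , m≤r , 2∣e , _ , 2ᵐ∤b))))) =
      2ᵐ∤b (subst (λ s → + s ∣ b) (sym (2¹⁺ᵐ⁻¹≡2ᵐ 2∣n)) (Equivalence.to (2∣e⇔2ᵐ∣b 2∣n m≤r) 2∣e))

  -- From prime powers to the modulus `n`.

  no-solution⇒obstruction : 1 ≤ n → (∀ i → t i ℕ.∣ n) →
    ¬ (∃ λ x → IsSolution n a b t x) → Obstruction n b r m e
  no-solution⇒obstruction 1≤n t∣n unsolvable =
    [ (λ obs → obs)
    , (λ s → contradiction (solvable⇒solution {{ℕ.>-nonZero 1≤n}} a b t t∣n s) unsolvable) ]′
      -- The obstruction refers to the fixed `n` while only the modulus `s` varies: an obstruction
      -- met at any prime is passed on unchanged, and otherwise the local solutions are glued.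
      (coprime-induction (λ s → Obstruction n b r m e ⊎ Solvable s c b)
        (inj₂ (solvable-1 c b)) combine n 1≤n at-prime-power)
    where
    combine : ∀ {s s′} → .{{NonZero s}} → .{{NonZero s′}} → Coprime s s′ →
      Obstruction n b r m e ⊎ Solvable s c b → Obstruction n b r m e ⊎ Solvable s′ c b →
      Obstruction n b r m e ⊎ Solvable (s ℕ.* s′) c b
    combine s⊥s′ (inj₁ obs) _ = inj₁ obs
    combine s⊥s′ (inj₂ _) (inj₁ obs) = inj₁ obs
    combine s⊥s′ (inj₂ sol) (inj₂ sol′) = inj₂ (solvable-* {c = c} {b} s⊥s′ sol sol′)
    at-prime-power : ∀ p j → Prime p → p ℕ.∣ n → p ^ j ℕ.∣ n →
      Obstruction n b r m e ⊎ Solvable (p ^ j) c b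
    -- The induction asks for every `p ^ j` dividing `n`; since `j ≤ r p`, a solution modulo
    -- `p ^ r p` restricts to it.
    at-prime-power p j pp p∣n pʲ∣n = map₂
      (solvable-∣ {c = c} {b} (^-monoʳ-∣ p {j} {r p} (∥⇒^∣⇒≤ p (r-exponent p pp p∣n) pʲ∣n)))
      (local-dichotomy pp p∣n)

corollary3p10 : (k n : ℕ) → 1 ≤ k → 1 ≤ n →
    (a : Vector ℤ k) (b : ℤ) → (∃ λ i → a i ≢ 0ℤ) →
    (t : Vector ℕ k) → (∀ i → 1 ≤ t i) → (∀ i → t i ℕ.∣ n) →
    (r m e : ℕ → ℕ) →
    (∀ p → Prime p → p ℕ.∣ n → p ^ r p ∥ + n) →
    (∀ p → Prime p → p ℕ.∣ n → IsLeastExponent p a t (m p)) →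
    (∀ p → Prime p → p ℕ.∣ n → e p ≡ countNotDivisible p (m p) a t) →
    (¬ (∃ λ x → IsSolution n a b t x)) ⇔
    ( (∃ λ p → Prime p × p ℕ.∣ n × m p ≤ r p × ¬ (+ (p ^ (m p ∸ 1)) ∣ b))
    ⊎ (∃ λ p → Prime p × p ℕ.∣ n × suc (r p) ≤ m p × ¬ (+ (p ^ r p) ∣ b))
    ⊎ (∃ λ p → Prime p × p ℕ.∣ n × m p ≤ r p × e p ≡ 1 × + (p ^ m p) ∣ b)
    ⊎ (2 ℕ.∣ n × m 2 ≤ r 2 × ¬ (2 ℕ.∣ e 2) × + (2 ^ m 2) ∣ b)
    ⊎ (2 ℕ.∣ n × m 2 ≤ r 2 × 2 ℕ.∣ e 2 × 2 ^ (m 2 ∸ 1) ∥ b) )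
corollary3p10 k n _ 1≤n a b _ t 1≤t t∣n r m e r-exponent m-least e-count = mk⇔
  (no-solution⇒obstruction a b t r m e r-exponent m-least e-count 1≤n t∣n)
  (obstruction⇒no-solution a b t r m e r-exponent m-least e-count 1≤t)
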